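{- Let $P$ be a hereditary property of graphs. The speed of $P$ is constant (that is, $P_n=\Theta(1)$) if and only if there is a constant $k$ such that the similarity difference of every graph in $P$ is at most $k$.
   Context: All graphs are finite, simple and undirected. A graph property is an infinite class of graphs closed under isomorphism. A property is hereditary if it is closed under taking induced subgraphs. $P_n$ denotes the number of labelled graphs on the vertex set $\{1,\dots,n\}$ that belong to $P$; the function $n\mapsto P_n$ is the speed of $P$. Two vertices $x,y$ of a graph $G$ are similar if there is no vertex $z\notin\{x,y\}$ adjacent to exactly one of $x$ and $y$. Similarity is an equivalence relation on $V(G)$; its classes are called similarity classes. Let $S(G)$ and $s(G)$ be the sizes of a largest and of a smallest similarity class in $G$, respectively. The similarity difference of $G$ is $S(G)-s(G)$. -}

module Defs where

open import Data.Bool.Base using (Bool; false; T; _xor_)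
open import Data.Bool.Properties using (T?)
open import Data.Fin.Base using (Fin)
open import Data.Fin.Properties using (_≟_; any?)
open import Data.List.Base using (List; allFin; filter; length; map)
open import Data.List.Extrema.Nat using (max; min)
open import Data.List.Relation.Unary.All using (All)
open import Data.Nat.Base using (ℕ; _*_; _∸_; _≤_)
open import Data.Product using (Σ; ∃-syntax; _×_; proj₁; proj₂)
open import Function.Base using (_on_)
open import Function.Bundles using (Inverse; _↔_; _↣_; Injection)
open import Level using (Level; 0ℓ; suc; _⊔_)
open import Relation.Binary.Bundles using (Setoid)
open import Relation.Binary.PropositionalEquality using (_≡_; _≢_; refl; sym; trans; setoid)
open import Relation.Nullary using (¬_; Dec; ¬?; _×-dec_)

private
  variable
    ℓ : Level
    m n : ℕ

record Graph (n : ℕ) : Set where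
  field
    adj        : Fin n → Fin n → Bool
    adj-sym    : ∀ x y → adj x y ≡ adj y x
    adj-irrefl : ∀ x → adj x x ≡ false

open Graph public

-- Equality of labelled graphs: same vertex set, same edges.
_≈_ : Graph n → Graph n → Set
G ≈ H = ∀ x y → adj G x y ≡ adj H x y

_≅_ : Graph m → Graph n → Set
_≅_ {m} {n} G H =
  Σ (Fin m ↔ Fin n) λ φ →
    ∀ x y → adj G x y ≡ adj H (Inverse.to φ x) (Inverse.to φ y)

-- H is an induced subgraph of G, up to the names of the vertices of H.
_⊑_ : Graph m → Graph n → Set
_⊑_ {m} {n} H G =
  Σ (Fin m ↣ Fin n) λ φ →
    ∀ x y → adj H x y ≡ adj G (Injection.to φ x) (Injection.to φ y)

-- A class closed under isomorphism is determined by its members with vertex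
-- set Fin n.  Infinitude is understood up to isomorphism: no finite list of
-- graphs represents all members.
record GraphProperty (ℓ : Level) : Set (suc ℓ) where
  field
    Member     : Graph n → Set ℓ
    iso-closed : {G : Graph m} {H : Graph n} → G ≅ H → Member G → Member H
    infinite   : (Gs : List (∃[ n ] Graph n)) →
                 ∃[ n ] Σ (Graph n) λ G →
                   Member G × All (λ H → ¬ (proj₂ H ≅ G)) Gs

open GraphProperty public using (Member)

Hereditary : GraphProperty ℓ → Set ℓ
Hereditary P =
  ∀ {m n} {H : Graph m} {G : Graph n} → H ⊑ G → Member P G → Member P H

LabelledMembers : GraphProperty ℓ → ℕ → Setoid ℓ 0ℓ
LabelledMembers P n = record
  { Carrier       = Σ (Graph n) (Member P)
  ; _≈_           = _≈_ on proj₁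
  ; isEquivalence = record
    { refl  = λ _ _ → refl
    ; sym   = λ p x y → sym (p x y)
    ; trans = λ p q x y → trans (p x y) (q x y)
    }
  }

-- Membership in P need not be decidable, so the cardinality P_n is specified
-- by a bijection with Fin (f n) rather than computed; f is unique.
IsSpeed : GraphProperty ℓ → (ℕ → ℕ) → Set ℓ
IsSpeed P f = ∀ n → Inverse (LabelledMembers P n) (setoid (Fin (f n)))

_=O_ : (ℕ → ℕ) → (ℕ → ℕ) → Set
f =O g = ∃[ c ] ∃[ N ] ∀ n → N ≤ n → f n ≤ c * g n

_=Θ_ : (ℕ → ℕ) → (ℕ → ℕ) → Set
f =Θ g = f =O g × g =O f

Similar : Graph n → Fin n → Fin n → Set
Similar G x y = ¬ (∃[ z ] z ≢ x × z ≢ y × T (adj G z x xor adj G z y))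

similar? : (G : Graph n) (x y : Fin n) → Dec (Similar G x y)
similar? G x y =
  ¬? (any? λ z → ¬? (z ≟ x) ×-dec ¬? (z ≟ y) ×-dec T? (adj G z x xor adj G z y))

similarityClass : Graph n → Fin n → List (Fin n)
similarityClass {n} G x = filter (similar? G x) (allFin n)

classSizes : Graph n → List ℕ
classSizes {n} G = map (λ x → length (similarityClass G x)) (allFin n)

-- The default values 0 and n do not affect the result when there is at least
-- one vertex, as every class size lies between them; on the graph without
-- vertices both extrema are 0.
largestClassSize : Graph n → ℕ
largestClassSize G = max 0 (classSizes G)

smallestClassSize : Graph n → ℕ
smallestClassSize {n} G = min n (classSizes G)

similarityDifference : Graph n → ℕ
similarityDifference G = largestClassSize G ∸ smallestClassSize G

{-# OPTIONS --safe #-}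
module Submission where

-- A large homogeneous set in a graph that is not itself complete or empty yields
-- a large induced star or a large induced edge with isolated vertices, or
-- the complement of one of these; call them spiders.  A spider on s + 2 vertices
-- has at least s + 1 labelled copies and similarity difference at least s − 2, so
-- under either condition on P the spiders in P are bounded in size.  Similarity
-- classes are homogeneous up to one vertex, so then a graph in P with a large
-- class is complete or empty and has difference 0.  By Ramsey's theorem all large
-- graphs in P are complete or empty, so the speed is at most 2 eventually.

open import Data.Bool.Base using (Bool; true; false; T; not; if_then_else_; _∨_; _xor_)
open import Data.Bool.Properties as Bool using (∨-comm; not-involutive; ¬-not; not-¬; xor-same)
open import Data.Empty using (⊥-elim)
open import Data.Fin.Base using (Fin; zero; suc; inject≤)
open import Data.Fin.Patterns using (0F; 1F; 2F)
open import Data.Fin.Permutation using (transpose; lift₀; _⟨$⟩ʳ_)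
open import Data.Fin.Properties
  using (_≟_; any?; injective⇒≤; inject≤-injective; suc-injective; 2↔Bool)
open import Data.List.Base
  using (List; []; _∷_; _++_; allFin; tabulate; filter; length; lookup; map; concatMap; upTo)
open import Data.List.Extrema.Nat
  using (argmax-sel; xs≤max; min≤xs; max≤v⁺; v≤min⁺)
open import Data.List.Membership.Propositional using (_∈_; _∉_; lose)
open import Data.List.Membership.Propositional.Properties
  using (∈-filter⁺; ∈-filter⁻; ∈-lookup; ∈-allFin; ∈-map⁺; ∈-map⁻; ∈-++⁺ˡ; ∈-++⁺ʳ; ∈-tabulate⁻; ∈-concatMap⁺; ∈-upTo⁺)
open import Data.List.Membership.Setoid.Properties using (index-injective)
open import Data.List.Properties using (length-++; length-tabulate; length-filter)
open import Data.List.Relation.Binary.Subset.Propositional using (_⊆_)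
open import Data.List.Relation.Unary.All as All using ([]; _∷_)
open import Data.List.Relation.Unary.All.Properties using (¬Any⇒All¬)
open import Data.List.Relation.Unary.AllPairs using ([]; _∷_)
open import Data.List.Relation.Unary.Any using (here; there; index)
open import Data.List.Relation.Unary.Unique.Propositional using (Unique)
open import Data.List.Relation.Unary.Unique.Propositional.Properties
  using (filter⁺; allFin⁺; tabulate⁺)
open import Data.Nat.Base using (ℕ; zero; suc; _+_; _∸_; _^_; _≤_; _<_; z≤n; s≤s; s≤s⁻¹)
open import Data.Nat.Properties as ℕ using (module ≤-Reasoning)
open import Data.Product using (∃-syntax; Σ-syntax; _×_; _,_; proj₁; proj₂)
open import Data.Sum.Base using (_⊎_; inj₁; inj₂)
open import Function.Base using (_∘_)
open import Function.Bundles using (_⇔_; _↣_; mk⇔; mk↣; Inverse; Injection)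
open import Function.Properties.Inverse using (↔⇒↣; ↔-sym)
open import Function.Construct.Identity using (↔-id)
open import Function.Definitions using (Injective)
open import Level using (Level)
open import Relation.Binary.PropositionalEquality
  using (_≡_; _≢_; refl; sym; trans; cong; cong₂; subst; setoid; ≢-sym)
open import Relation.Nullary using (¬_; yes; no; does)
open import Relation.Nullary.Decidable using (does-⇔; dec-true; dec-false; _×-dec_; ¬?)
open import Relation.Unary using (Decidable)
open import Defs

private
  variable
    ℓ : Level
    A : Set ℓ
    m n s : ℕ
    b : Bool

-- Duplicate-free lists and their lengths.

lookup-injective : {xs : List A} → Unique xs → Injective _≡_ _≡_ (lookup xs)
lookup-injective (x∉xs ∷ u) {zero}  {zero}  eq = refl
lookup-injective (x∉xs ∷ u) {zero}  {suc j} eq = ⊥-elim (All.lookup x∉xs (∈-lookup j) eq)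
lookup-injective (x∉xs ∷ u) {suc i} {zero}  eq = ⊥-elim (All.lookup x∉xs (∈-lookup i) (sym eq))
lookup-injective (x∉xs ∷ u) {suc i} {suc j} eq = cong suc (lookup-injective u eq)

-- Sending each position in `xs` to a position of the same element in `ys` is injective, since equal
-- positions in `ys` carry equal elements and `xs` has no repetitions.
unique-⊆⇒length≤ : {xs ys : List A} → Unique xs → xs ⊆ ys → length xs ≤ length ys
unique-⊆⇒length≤ {A = A} {xs = xs} u sub = injective⇒≤ {f = λ i → index (sub (∈-lookup {xs = xs} i))}
  λ {i} {j} eq → lookup-injective u (index-injective (setoid A) (sub (∈-lookup i)) (sub (∈-lookup j)) eq)

∉⇒unique-∷ : {x : A} {xs : List A} → x ∉ xs → Unique xs → Unique (x ∷ xs)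
∉⇒unique-∷ x∉xs u = ¬Any⇒All¬ _ x∉xs ∷ u

-- Sizes of similarity classes.

length-similarityClass≤ : (G : Graph n) (x : Fin n) → length (similarityClass G x) ≤ n
length-similarityClass≤ {n} G x =
  ℕ.≤-trans (length-filter (similar? G x) (allFin n)) (ℕ.≤-reflexive (length-tabulate {n = n} (λ i → i)))

unique-similarityClass : (G : Graph n) (x : Fin n) → Unique (similarityClass G x)
unique-similarityClass {n} G x = filter⁺ (similar? G x) (allFin⁺ n)

≤-length-similarityClass : (G : Graph n) (x : Fin n) {ys : List (Fin n)} →
  Unique ys → (∀ {y} → y ∈ ys → Similar G x y) → length ys ≤ length (similarityClass G x)
≤-length-similarityClass G x u sim =
  unique-⊆⇒length≤ u λ y∈ys → ∈-filter⁺ (similar? G x) (∈-allFin _) (sim y∈ys)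

length-similarityClass-⊆ : (G : Graph n) (x : Fin n) {ys : List (Fin n)} →
  (∀ {y} → Similar G x y → y ∈ ys) → length (similarityClass G x) ≤ length ys
length-similarityClass-⊆ G x sub =
  unique-⊆⇒length≤ (unique-similarityClass G x)
    λ y∈C → sub (proj₂ (∈-filter⁻ (similar? G x) {xs = allFin _} y∈C))

length-class≤largest : (G : Graph n) (x : Fin n) → length (similarityClass G x) ≤ largestClassSize G
length-class≤largest G x =
  All.lookup (xs≤max 0 (classSizes G)) (∈-map⁺ (λ y → length (similarityClass G y)) (∈-allFin x))

smallest≤length-class : (G : Graph n) (x : Fin n) → smallestClassSize G ≤ length (similarityClass G x)
smallest≤length-class G x =
  All.lookup (min≤xs _ (classSizes G)) (∈-map⁺ (λ y → length (similarityClass G y)) (∈-allFin x))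

-- A set inside one class bounds the largest size from below and a set covering another class bounds
-- the smallest from above, so no class has to be determined exactly.
≤-similarityDifference : (G : Graph n) {x y : Fin n} {xs ys : List (Fin n)} {k l : ℕ} →
  Unique xs → (∀ {z} → z ∈ xs → Similar G x z) → k ≤ length xs →
  (∀ {z} → Similar G y z → z ∈ ys) → length ys ≤ l →
  k ∸ l ≤ similarityDifference G
≤-similarityDifference G {x} {y} u large k≤ small ≤l = ℕ.∸-mono
  (ℕ.≤-trans k≤ (ℕ.≤-trans (≤-length-similarityClass G x u large) (length-class≤largest G x)))
  (ℕ.≤-trans (smallest≤length-class G y) (ℕ.≤-trans (length-similarityClass-⊆ G y small) ≤l))

similar⇒≡ : (G : Graph n) {x y z : Fin n} → Similar G x y → z ≢ x → z ≢ y → adj G z x ≡ adj G z y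
similar⇒≡ G {x} {y} {z} sim z≢x z≢y with adj G z x | adj G z y | (λ t → sim (z , z≢x , z≢y , t))
... | false | false | _ = refl
... | false | true  | h = ⊥-elim (h _)
... | true  | false | h = ⊥-elim (h _)
... | true  | true  | _ = refl

≡⇒similar : (G : Graph n) {x y : Fin n} →
  (∀ z → z ≢ x → z ≢ y → adj G z x ≡ adj G z y) → Similar G x y
≡⇒similar G {x} {y} eq (z , z≢x , z≢y , t) =
  subst T (trans (cong (_xor adj G z y) (eq z z≢x z≢y)) (xor-same (adj G z y))) t

largestClass : (G : Graph n) → 0 < largestClassSize G →
  ∃[ x ] largestClassSize G ≡ length (similarityClass G x)
largestClass G pos with argmax-sel (λ k → k) 0 (classSizes G)
-- The maximum could be the default value 0 instead of a class size; `pos` excludes this.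
... | inj₁ eq = ⊥-elim (ℕ.<⇒≢ pos (sym eq))
... | inj₂ S∈ with ∈-map⁻ (λ x → length (similarityClass G x)) S∈
...   | x , _ , eq = x , eq

-- Homogeneous sets and monochromatic graphs.

Homogeneous : Graph n → Bool → List (Fin n) → Set
Homogeneous G b xs = ∀ {x y} → x ∈ xs → y ∈ xs → x ≢ y → adj G x y ≡ b

Monochromatic : Graph n → Bool → Set
Monochromatic G b = ∀ x y → x ≢ y → adj G x y ≡ b

monochromatic? : (G : Graph n) (b : Bool) →
  Monochromatic G b ⊎ (∃[ x ] ∃[ y ] x ≢ y × adj G x y ≡ not b)
monochromatic? G b with any? (λ x → any? (λ y → ¬? (x ≟ y) ×-dec (adj G x y Bool.≟ not b)))
... | yes p = inj₂ p
... | no ¬p = inj₁ λ x y x≢y →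
      trans (¬-not λ eq → ¬p (x , y , x≢y , eq)) (not-involutive b)

monochromatic⇒≈ : {G H : Graph n} → Monochromatic G b → Monochromatic H b → G ≈ H
monochromatic⇒≈ {G = G} {H} g h x y with x ≟ y
... | yes refl = trans (adj-irrefl G x) (sym (adj-irrefl H x))
... | no  x≢y  = trans (g x y x≢y) (sym (h x y x≢y))

-- All vertices are pairwise similar, so every class has size `n`. The defaults 0 and `n` of the
-- extrema fit the same bounds, which covers the graph without vertices.
monochromatic⇒difference≡0 : (G : Graph n) → Monochromatic G b → similarityDifference G ≡ 0
monochromatic⇒difference≡0 {n} G mono = ℕ.m≤n⇒m∸n≡0 (ℕ.≤-trans
  (max≤v⁺ {xs = classSizes G} z≤n (All.tabulate upper))
  (v≤min⁺ {xs = classSizes G} ℕ.≤-refl (All.tabulate lower)))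
  where
  upper : ∀ {k} → k ∈ classSizes G → k ≤ n
  upper k∈ with x , _ , refl ← ∈-map⁻ (λ x → length (similarityClass G x)) k∈ =
    length-similarityClass≤ G x
  lower : ∀ {k} → k ∈ classSizes G → n ≤ k
  lower k∈ with x , _ , refl ← ∈-map⁻ (λ x → length (similarityClass G x)) k∈ =
    ℕ.≤-trans (ℕ.≤-reflexive (sym (length-tabulate {n = n} (λ i → i))))
      (≤-length-similarityClass G x (allFin⁺ n) λ _ →
        ≡⇒similar G λ z z≢x z≢y → trans (mono z x z≢x) (sym (mono z _ z≢y)))

-- Spiders: embeddings and similarity difference.

incident : Fin n → Fin n → Fin n → Bool
incident x y i = does (x ≟ i) ∨ does (y ≟ i)

-- The pair ij has colour not b, the other pairs at i have colour d, and all
-- remaining pairs have colour b: for d = not b a star centred at i (or its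
-- complement), for d = b a single edge plus isolated vertices (or its complement).
spider : (b d : Bool) (i j : Fin n) → Graph n
spider b d i j = record
  { adj        = colour
  ; adj-sym    = λ x y → cong₂ (λ e c → if e then false else c)
      (does-⇔ (mk⇔ sym sym) (x ≟ y) (y ≟ x))
      (cong₂ (λ p q → if p then (if q then not b else d) else b)
        (∨-comm (does (x ≟ i)) (does (y ≟ i))) (∨-comm (does (x ≟ j)) (does (y ≟ j))))
  ; adj-irrefl = λ x → cong (if_then false else tint x x) (dec-true (x ≟ x) refl)
  }
  where
  tint colour : Fin _ → Fin _ → Bool
  tint x y = if incident x y i then (if incident x y j then not b else d) else b
  colour x y = if does (x ≟ y) then false else tint x y

-- The colour of a pair depends only on which vertices are equal to each other, to `i` or to `j`,
-- and an injection preserves and reflects equality.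
spider-relabel : (b d : Bool) (φ : Fin m ↣ Fin n) (i j : Fin m) →
  spider b d i j ⊑ spider b d (Injection.to φ i) (Injection.to φ j)
spider-relabel b d φ i j = φ , λ x y → cong₂ (λ e c → if e then false else c) (same x y)
  (cong₂ (λ p q → if p then (if q then not b else d) else b)
    (cong₂ _∨_ (same x i) (same y i)) (cong₂ _∨_ (same x j) (same y j)))
  where
  open Injection φ using (to; injective)
  same : ∀ x y → does (x ≟ y) ≡ does (to x ≟ to y)
  same x y = does-⇔ (mk⇔ (cong to) injective) (x ≟ y) (to x ≟ to y)

spider-⊑ : (G : Graph n) (b d : Bool) (φ : Fin (2 + s) ↣ Fin n) → let open Injection φ in
  adj G (to 0F) (to 1F) ≡ not b →
  (∀ t → adj G (to 0F) (to (suc (suc t))) ≡ d) →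
  (∀ t → adj G (to 1F) (to (suc (suc t))) ≡ b) →
  (∀ t t′ → t ≢ t′ → adj G (to (suc (suc t))) (to (suc (suc t′))) ≡ b) →
  spider b d 0F 1F ⊑ G
spider-⊑ {s = s} G b d φ ij i- j- rest = φ , agree
  where
  open Injection φ using (to)
  agree : ∀ x y → adj (spider b d 0F 1F) x y ≡ adj G (to x) (to y)
  agree 0F 0F = sym (adj-irrefl G _)
  agree 0F 1F = sym ij
  agree 1F 0F = sym (trans (adj-sym G _ _) ij)
  agree 1F 1F = sym (adj-irrefl G _)
  agree 0F (suc (suc t)) = sym (i- t)
  agree (suc (suc t)) 0F = sym (trans (adj-sym G _ _) (i- t))
  agree 1F (suc (suc t)) = sym (j- t)
  agree (suc (suc t)) 1F = sym (trans (adj-sym G _ _) (j- t))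
  agree (suc (suc t)) (suc (suc t′)) with t ≟ t′
  ... | yes refl = sym (adj-irrefl G _)
  ... | no t≢t′ = sym (rest t t′ t≢t′)

spider-⊑-lists : (G : Graph n) (b d : Bool) {i j : Fin n} {ws : List (Fin n)} →
  Unique (i ∷ j ∷ ws) → s ≤ length ws → adj G i j ≡ not b →
  (∀ {w} → w ∈ ws → adj G i w ≡ d) → (∀ {w} → w ∈ ws → adj G j w ≡ b) →
  Homogeneous G b ws → spider {2 + s} b d 0F 1F ⊑ G
spider-⊑-lists {s = s} G b d {i} {j} {ws} u s≤ ij i- j- hom =
  spider-⊑ G b d (mk↣ injective) ij (λ t → i- (∈-lookup _)) (λ t → j- (∈-lookup _))
    λ t t′ t≢t′ → hom (∈-lookup _) (∈-lookup _)
      λ eq → t≢t′ (suc-injective (suc-injective (injective eq)))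
  where
  -- `inject≤` keeps the first `s` entries of `ws` as leaves, so a lower bound on its length
  -- suffices.
  injective : Injective _≡_ _≡_ λ t → lookup (i ∷ j ∷ ws) (inject≤ {2 + s} t (s≤s (s≤s s≤)))
  injective eq = inject≤-injective _ _ _ _ (lookup-injective u eq)

-- The head of `ws` takes the role of `j`: its pair with the centre `x` has colour `not b` and its
-- pairs with the other leaves have colour `b`. Hence one vertex more than `s` is required.
star-⊑ : (G : Graph n) (b : Bool) {x : Fin n} {ws : List (Fin n)} →
  x ∉ ws → Unique ws → suc s ≤ length ws → (∀ {w} → w ∈ ws → adj G x w ≡ not b) →
  Homogeneous G b ws → spider {2 + s} b (not b) 0F 1F ⊑ G
star-⊑ G b {x} {w ∷ ws} x∉ (w∉ws ∷ u) (s≤s s≤) x- hom =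
  spider-⊑-lists G b (not b) (∉⇒unique-∷ x∉ (w∉ws ∷ u)) s≤ (x- (here refl)) (x- ∘ there)
    (λ w′∈ws → hom (here refl) (there w′∈ws) (All.lookup w∉ws w′∈ws))
    λ p q → hom (there p) (there q)

-- If many vertices of W have an exceptional pair to x or to y they form a star;
-- otherwise many have none, and xy is a single edge next to them.
homogeneous⇒spider-⊑ : (G : Graph n) (b : Bool) (s : ℕ) {W : List (Fin n)} {x y : Fin n} →
  Unique W → Homogeneous G b W → 2 + (s + (s + s)) ≤ length W →
  x ≢ y → adj G x y ≡ not b → ∃[ d ] spider {2 + s} b d 0F 1F ⊑ G
homogeneous⇒spider-⊑ {n} G b s {W} {x} {y} u hom large x≢y xy =
  by-size (ℕ.≤-<-connex (length (exceptions x)) s) (ℕ.≤-<-connex (length (exceptions y)) s)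
  where
  -- The vertex `v` must be excluded explicitly: for `b = true` the diagonal value `false` of
  -- `adj G v v` equals `not b`.
  exceptional? : ∀ v → Decidable λ w → v ≢ w × adj G v w ≡ not b
  exceptional? v w = ¬? (v ≟ w) ×-dec (adj G v w Bool.≟ not b)

  regular? : Decidable λ w → (x ≢ w × y ≢ w) × (adj G x w ≡ b × adj G y w ≡ b)
  regular? w = (¬? (x ≟ w) ×-dec ¬? (y ≟ w)) ×-dec ((adj G x w Bool.≟ b) ×-dec (adj G y w Bool.≟ b))

  exceptions : Fin n → List (Fin n)
  exceptions v = filter (exceptional? v) W

  regulars : List (Fin n)
  regulars = filter regular? W

  cover : W ⊆ x ∷ y ∷ exceptions x ++ exceptions y ++ regulars
  cover {w} w∈W with x ≟ w | y ≟ w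
  ... | yes refl | _ = here refl
  ... | no _ | yes refl = there (here refl)
  ... | no x≢w | no y≢w with adj G x w Bool.≟ not b | adj G y w Bool.≟ not b
  ...   | yes xw | _ = there (there (∈-++⁺ˡ (∈-filter⁺ (exceptional? x) w∈W (x≢w , xw))))
  ...   | no _ | yes yw =
          there (there (∈-++⁺ʳ (exceptions x) (∈-++⁺ˡ (∈-filter⁺ (exceptional? y) w∈W (y≢w , yw)))))
  ...   | no ¬xw | no ¬yw =
          there (there (∈-++⁺ʳ (exceptions x) (∈-++⁺ʳ (exceptions y)
            (∈-filter⁺ regular? w∈W ((x≢w , y≢w) ,
              (trans (¬-not ¬xw) (not-involutive b) , trans (¬-not ¬yw) (not-involutive b)))))))

  star : ∀ v → s < length (exceptions v) → spider {2 + s} b (not b) 0F 1F ⊑ G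
  star v s< = star-⊑ G b (λ v∈ → proj₁ (exception v∈) refl) (filter⁺ (exceptional? v) u) s<
    (proj₂ ∘ exception) λ p q → hom (member p) (member q)
    where
    exception : ∀ {w} → w ∈ exceptions v → v ≢ w × adj G v w ≡ not b
    exception w∈ = proj₂ (∈-filter⁻ (exceptional? v) {xs = W} w∈)
    member : exceptions v ⊆ W
    member w∈ = proj₁ (∈-filter⁻ (exceptional? v) {xs = W} w∈)

  by-size : length (exceptions x) ≤ s ⊎ s < length (exceptions x) →
    length (exceptions y) ≤ s ⊎ s < length (exceptions y) → ∃[ d ] spider {2 + s} b d 0F 1F ⊑ G
  by-size (inj₂ s<) _         = not b , star x s<
  by-size (inj₁ _)  (inj₂ s<) = not b , star y s<
  by-size (inj₁ x≤) (inj₁ y≤) = b , spider-⊑-lists G b b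
    (∉⇒unique-∷ x∉ (∉⇒unique-∷ (λ y∈ → proj₂ (proj₁ (regular y∈)) refl) (filter⁺ regular? u)))
    many xy (proj₁ ∘ proj₂ ∘ regular) (proj₂ ∘ proj₂ ∘ regular) λ p q → hom (member p) (member q)
    where
    open ≤-Reasoning
    regular : ∀ {w} → w ∈ regulars → (x ≢ w × y ≢ w) × (adj G x w ≡ b × adj G y w ≡ b)
    regular w∈ = proj₂ (∈-filter⁻ regular? {xs = W} w∈)
    member : regulars ⊆ W
    member w∈ = proj₁ (∈-filter⁻ regular? {xs = W} w∈)
    x∉ : x ∉ y ∷ regulars
    x∉ (here x≡y)  = x≢y x≡y
    x∉ (there x∈) = proj₁ (proj₁ (regular x∈)) refl
    -- The bound `2 + (s + (s + s))` pays for `x` and `y` themselves and for at most `s` exceptions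
    -- at each of them, leaving `s` regular vertices.
    many : s ≤ length regulars
    many = ℕ.+-cancelˡ-≤ s _ _ (ℕ.+-cancelˡ-≤ s _ _ (s≤s⁻¹ (s≤s⁻¹ (begin
      2 + (s + (s + s))
        ≤⟨ large ⟩
      length W
        ≤⟨ unique-⊆⇒length≤ u cover ⟩
      2 + length (exceptions x ++ exceptions y ++ regulars)
        ≡⟨ cong (2 +_) (trans (length-++ (exceptions x)) (cong (length (exceptions x) +_) (length-++ (exceptions y)))) ⟩
      2 + (length (exceptions x) + (length (exceptions y) + length regulars))
        ≤⟨ ℕ.+-monoʳ-≤ 2 (ℕ.+-mono-≤ x≤ (ℕ.+-monoˡ-≤ (length regulars) y≤)) ⟩
      2 + (s + (s + length regulars)) ∎))))

spider-leaves-similar : (b d : Bool) (t t′ : Fin s) →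
  Similar (spider {2 + s} b d 0F 1F) (suc (suc t)) (suc (suc t′))
spider-leaves-similar b d t t′ = ≡⇒similar (spider b d 0F 1F) λ where
  0F            _   _    → refl
  1F            _   _    → refl
  (suc (suc r)) r≢t r≢t′ → trans
    (cong (if_then false else b) (dec-false (r ≟ t) (r≢t ∘ cong (λ i → suc (suc i)))))
    (sym (cong (if_then false else b) (dec-false (r ≟ t′) (r≢t′ ∘ cong (λ i → suc (suc i))))))

-- The vertex `1F` separates `0F` from every leaf: its pair with `0F` has colour `not b`, its pair
-- with a leaf colour `b`. For `d = b` the vertex `1F` does lie in the class of `0F`, hence the list
-- of two.
spider-class-0 : (b d : Bool) {y : Fin (2 + s)} →
  Similar (spider b d 0F 1F) 0F y → y ∈ 0F ∷ 1F ∷ []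
spider-class-0 b d {0F} _ = here refl
spider-class-0 b d {1F} _ = there (here refl)
spider-class-0 b d {suc (suc t)} sim =
  ⊥-elim (not-¬ {x = b} refl (sym (similar⇒≡ (spider b d 0F 1F) {z = 1F} sim (λ ()) (λ ()))))

-- The `s` leaves are pairwise similar, while the class of `0F` has at most two elements. The case
-- split provides the leaf `2F` as representative.
spider-difference : (b d : Bool) (s : ℕ) → s ∸ 2 ≤ similarityDifference (spider {2 + s} b d 0F 1F)
spider-difference b d zero    = z≤n
spider-difference b d (suc s) =
  ≤-similarityDifference (spider b d 0F 1F) {xs = tabulate leaf} {k = suc s} {l = 2}
    (tabulate⁺ (suc-injective ∘ suc-injective)) leaves
    (ℕ.≤-reflexive (sym (length-tabulate leaf))) (spider-class-0 b d) ℕ.≤-refl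
  where
  leaf : Fin (suc s) → Fin (3 + s)
  leaf t = suc (suc t)
  leaves : ∀ {y} → y ∈ tabulate leaf → Similar (spider b d 0F 1F) 2F y
  leaves y∈ with t , refl ← ∈-tabulate⁻ {f = leaf} y∈ = spider-leaves-similar b d 0F t

-- Ramsey's theorem for two colours.

HomogeneousSublist : Graph n → List (Fin n) → Bool → ℕ → Set
HomogeneousSublist G xs b k =
  ∃[ ys ] Unique ys × ys ⊆ xs × length ys ≡ k × Homogeneous G b ys

extend-homogeneous : (G : Graph n) (b : Bool) {v : Fin n} {xs : List (Fin n)} {k : ℕ} → v ∉ xs →
  HomogeneousSublist G (filter (λ w → adj G v w Bool.≟ b) xs) b k →
  HomogeneousSublist G (v ∷ xs) b (suc k)
extend-homogeneous G b {v} {xs} v∉xs (ys , u , ys⊆ , size , hom) =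
  v ∷ ys , ∉⇒unique-∷ (v∉xs ∘ proj₁ ∘ split) u , sub , cong suc size , hom′
  where
  split : ∀ {w} → w ∈ ys → w ∈ xs × adj G v w ≡ b
  split w∈ys = ∈-filter⁻ (λ w → adj G v w Bool.≟ b) {xs = xs} (ys⊆ w∈ys)
  sub : v ∷ ys ⊆ v ∷ xs
  sub (here refl)  = here refl
  sub (there w∈ys) = there (proj₁ (split w∈ys))
  hom′ : Homogeneous G b (v ∷ ys)
  hom′ (here refl) (here refl) v≢v = ⊥-elim (v≢v refl)
  hom′ (here refl) (there q)   _   = proj₂ (split q)
  hom′ (there p)   (here refl) _   = trans (adj-sym G _ _) (proj₂ (split p))
  hom′ (there p)   (there q)   x≢y = hom p q x≢y

weaken-homogeneous : (G : Graph n) (c b : Bool) {v : Fin n} {xs : List (Fin n)} {k : ℕ} →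
  HomogeneousSublist G (filter (λ w → adj G v w Bool.≟ c) xs) b k →
  HomogeneousSublist G (v ∷ xs) b k
weaken-homogeneous G c b {v} {xs} (ys , u , ys⊆ , rest) =
  ys , u , (λ w∈ys → there (proj₁ (∈-filter⁻ (λ w → adj G v w Bool.≟ c) {xs = xs} (ys⊆ w∈ys)))) , rest

-- The remaining vertices are split by the colour of their pair with the first vertex `v`. One side
-- keeps at least half of `2 ^ (s + t)`; recursion there lowers the target of that side's colour by
-- one, and `v` extends a set of this colour.
ramsey : (G : Graph n) (s t : ℕ) (xs : List (Fin n)) → Unique xs → 2 ^ (s + t) ≤ length xs →
  HomogeneousSublist G xs true s ⊎ HomogeneousSublist G xs false t
ramsey G zero    t       xs u large = inj₁ ([] , [] , (λ ()) , refl , λ ())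
ramsey G (suc s) zero    xs u large = inj₂ ([] , [] , (λ ()) , refl , λ ())
ramsey G (suc s) (suc t) [] u large = ⊥-elim (ℕ.<⇒≱ (ℕ.m^n>0 2 (suc s + suc t)) large)
ramsey {n} G (suc s) (suc t) (v ∷ xs) (v∉ ∷ u) large =
  by-size (ℕ.≤-<-connex (2 ^ (s + suc t)) (length (side true)))
  where
  v∉xs : v ∉ xs
  v∉xs v∈ = All.lookup v∉ v∈ refl

  side : Bool → List (Fin n)
  side b = filter (λ w → adj G v w Bool.≟ b) xs

  cover : xs ⊆ side true ++ side false
  cover {w} w∈ with adj G v w in eq
  ... | true  = ∈-++⁺ˡ (∈-filter⁺ (λ w → adj G v w Bool.≟ true) w∈ eq)
  ... | false = ∈-++⁺ʳ (side true) (∈-filter⁺ (λ w → adj G v w Bool.≟ false) w∈ eq)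

  by-size : 2 ^ (s + suc t) ≤ length (side true) ⊎ length (side true) < 2 ^ (s + suc t) →
    HomogeneousSublist G (v ∷ xs) true (suc s) ⊎ HomogeneousSublist G (v ∷ xs) false (suc t)
  by-size (inj₁ big) with ramsey G s (suc t) (side true) (filter⁺ (λ w → adj G v w Bool.≟ _) u) big
  ... | inj₁ h = inj₁ (extend-homogeneous G true v∉xs h)
  ... | inj₂ h = inj₂ (weaken-homogeneous G true false h)
  by-size (inj₂ few) with ramsey G (suc s) t (side false) (filter⁺ (λ w → adj G v w Bool.≟ _) u) many
    where
    open ≤-Reasoning
    many : 2 ^ (suc s + t) ≤ length (side false)
    -- The unit counted for `v` is absorbed by the strict inequality `few`.
    many = ℕ.+-cancelˡ-≤ (2 ^ (s + suc t)) _ _ (begin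
      2 ^ (s + suc t) + 2 ^ (suc s + t)
        ≡⟨ cong (2 ^ (s + suc t) +_) (trans (cong (2 ^_) (sym (ℕ.+-suc s t))) (sym (ℕ.+-identityʳ _))) ⟩
      2 ^ (suc s + suc t)
        ≤⟨ large ⟩
      suc (length xs)
        ≤⟨ s≤s (unique-⊆⇒length≤ u cover) ⟩
      suc (length (side true ++ side false))
        ≡⟨ cong suc (length-++ (side true)) ⟩
      suc (length (side true)) + length (side false)
        ≤⟨ ℕ.+-monoˡ-≤ (length (side false)) few ⟩
      2 ^ (s + suc t) + length (side false) ∎)
  ... | inj₁ h = inj₁ (weaken-homogeneous G false true h)
  ... | inj₂ h = inj₂ (extend-homogeneous G false v∉xs h)

-- Homogeneity of similarity classes.

locally-constant⇒constant : {B : Set} (f : A → B) (xs : List A) → B →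
  (∀ {x y} → x ∈ xs → y ∈ xs → f x ≡ f y) → ∃[ c ] ∀ {x} → x ∈ xs → f x ≡ c
-- The given element of `B` serves as the value on the empty list, as for the class of a vertex
-- similar only to itself.
locally-constant⇒constant f []       c eq = c , λ ()
locally-constant⇒constant f (x ∷ xs) c eq = f x , λ y∈ → eq y∈ (here refl)

-- For distinct `y` and `z` in the class of `x`, both other than `x`, the pair `yz` has the colour
-- of `yx` because `z` is similar to `x`, and by symmetry that of `zx`. So all pairs at `x` share
-- one colour, which the pairs inside `W` inherit. Leaving out `x` costs one vertex.
similarityClass-homogeneous : (G : Graph n) (x : Fin n) → ∃[ b ] Σ[ W ∈ List (Fin n) ]
  Unique W × Homogeneous G b W × length (similarityClass G x) ≤ suc (length W)
similarityClass-homogeneous G x =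
  proj₁ constant , W , filter⁺ other? (unique-similarityClass G x) ,
  (λ y∈ z∈ y≢z → trans (sym (pair y∈ z∈ y≢z)) (proj₂ constant y∈)) ,
  unique-⊆⇒length≤ (unique-similarityClass G x) cover
  where
  other? : Decidable (x ≢_)
  other? y = ¬? (x ≟ y)
  W = filter other? (similarityClass G x)

  pair : ∀ {y z} → y ∈ W → z ∈ W → y ≢ z → adj G y x ≡ adj G y z
  pair y∈ z∈ y≢z = similar⇒≡ G
    (proj₂ (∈-filter⁻ (similar? G x) {xs = allFin _}
      (proj₁ (∈-filter⁻ other? {xs = similarityClass G x} z∈))))
    (≢-sym (proj₂ (∈-filter⁻ other? {xs = similarityClass G x} y∈))) y≢z

  constant : ∃[ b ] ∀ {y} → y ∈ W → adj G y x ≡ b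
  constant = locally-constant⇒constant (λ y → adj G y x) W true same
    where
    same : ∀ {y z} → y ∈ W → z ∈ W → adj G y x ≡ adj G z x
    same {y} {z} y∈ z∈ with y ≟ z
    ... | yes refl = refl
    ... | no y≢z = trans (pair y∈ z∈ y≢z) (trans (adj-sym G y z) (sym (pair z∈ y∈ (≢-sym y≢z))))

  cover : similarityClass G x ⊆ x ∷ W
  cover {y} y∈ with x ≟ y
  ... | yes refl = here refl
  ... | no x≢y = there (∈-filter⁺ other? y∈ x≢y)

-- Labelled members and the speed.

induced : (G : Graph n) (φ : Fin m → Fin n) → Graph m
induced G φ = record
  { adj        = λ x y → adj G (φ x) (φ y)
  ; adj-sym    = λ x y → adj-sym G (φ x) (φ y)
  ; adj-irrefl = λ x → adj-irrefl G (φ x)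
  }

transpose-i≡j : (i j : Fin n) → transpose i j ⟨$⟩ʳ i ≡ j
transpose-i≡j i j rewrite dec-true (i ≟ i) refl = refl

module _ {ℓ : Level} (P : GraphProperty ℓ) (hereditary : Hereditary P)
         (speed : ℕ → ℕ) (isSpeed : IsSpeed P speed) where

  -- Different labelled members receive different codes under the speed bijection, because decoding
  -- recovers a graph up to `≈`.
  injective⇒≤speed : (G : Fin m → Graph n) → (∀ i → Member P (G i)) →
    (∀ {i j} → G i ≈ G j → i ≡ j) → m ≤ speed n
  injective⇒≤speed {n = n} G G∈P G-injective =
    injective⇒≤ {f = λ i → to (G i , G∈P i)} λ {i} {j} eq → G-injective λ x y →
      trans (sym (strictlyInverseʳ (G i , G∈P i) x y)) (inverseʳ {G j , G∈P j} eq x y)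
    where open Inverse (isSpeed n)

  -- The role of `j` is fixed at `0F` and that of `i` runs through the other vertices. For either
  -- value of `d` the only pair of colour `not b` at `0F` is the one with `i`, so the copies are
  -- distinct.
  spider-copies : (b d : Bool) → Member P (spider {2 + s} b d 0F 1F) → suc s ≤ speed (2 + s)
  spider-copies {s} b d spider∈P = injective⇒≤speed copy copy∈P copy-injective
    where
    copy : Fin (suc s) → Graph (2 + s)
    copy i = spider b d (suc i) 0F

    copy∈P : ∀ i → Member P (copy i)
    -- Swapping `0F` and `1F` puts `j` at `0F`; a transposition fixing `0F` then relates `suc i` to
    -- `1F`.
    copy∈P i = hereditary {G = spider b d 1F 0F}
      (subst (λ k → copy i ⊑ spider b d (suc k) 0F) (transpose-i≡j i 0F)
        (spider-relabel b d (↔⇒↣ (lift₀ (transpose i 0F))) (suc i) 0F))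
      (hereditary (spider-relabel b d (↔⇒↣ (transpose 0F 1F)) 1F 0F) spider∈P)

    copy-injective : ∀ {i j} → copy i ≈ copy j → i ≡ j
    copy-injective {i} {j} eq with i ≟ j | trans (sym own) (eq (suc i) 0F)
      where
      own : adj (copy i) (suc i) 0F ≡ not b
      own = cong (λ e → if e ∨ false then not b else b) (dec-true (i ≟ i) refl)
    ... | yes i≡j | _ = i≡j
    ... | no  _   | r = ⊥-elim (not-¬ refl (sym r))

  -- The inverse speed bijections list all members with fewer than `n` vertices. Infinitude gives a
  -- member isomorphic to none of them; it has at least `n` vertices, and its first `n` induce the
  -- required graph.
  member-of-size : ∀ n → Σ[ G ∈ Graph n ] Member P G
  member-of-size n with GraphProperty.infinite P smaller
    where
    smaller : List (∃[ m ] Graph m)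
    smaller = concatMap (λ m → map (λ i → m , proj₁ (Inverse.from (isSpeed m) i)) (allFin (speed m))) (upTo n)
  ... | m , G , G∈P , new with ℕ.≤-<-connex n m
  ...   | inj₁ n≤m = induced G (λ i → inject≤ i n≤m) ,
          hereditary (mk↣ (inject≤-injective n≤m n≤m _ _) , λ _ _ → refl) G∈P
  ...   | inj₂ m<n = ⊥-elim (All.lookup new
          (∈-concatMap⁺ _ (lose (∈-upTo⁺ m<n) (∈-map⁺ _ (∈-allFin (to (G , G∈P))))))
          (↔-id _ , strictlyInverseʳ (G , G∈P)))
    where open Inverse (isSpeed m)

  0<speed : ∀ n → 0 < speed n
  0<speed n = injective⇒≤speed {m = 1} (λ _ → proj₁ (member-of-size n)) (λ _ → proj₂ (member-of-size n))
    λ { {0F} {0F} _ → refl }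

  -- Bounding and excluding spiders.

  NoSpider : ℕ → Set ℓ
  NoSpider s = ∀ b d → ¬ Member P (spider {2 + s} b d 0F 1F)

  bounded-speed⇒no-spider : (c N : ℕ) → (∀ n → N ≤ n → speed n ≤ c) → NoSpider (N + c)
  -- With `N + c` leaves the number of vertices is beyond the threshold `N`, and the `N + c + 1`
  -- copies outnumber `c`.
  bounded-speed⇒no-spider c N bounded b d spider∈P = ℕ.<⇒≱ (s≤s (ℕ.m≤n+m c N))
    (ℕ.≤-trans (spider-copies b d spider∈P) (bounded (2 + (N + c)) (ℕ.m≤n⇒m≤o+n 2 (ℕ.m≤m+n N c))))

  bounded-difference⇒no-spider : (k s : ℕ) → k < s ∸ 2 →
    (∀ {n} (G : Graph n) → Member P G → similarityDifference G ≤ k) → NoSpider s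
  bounded-difference⇒no-spider k s k< bounded b d spider∈P =
    ℕ.<⇒≱ k< (ℕ.≤-trans (spider-difference b d s) (bounded (spider b d 0F 1F) spider∈P))

  -- A pair of the other colour anywhere in `G`, inside `W` or not, would yield a spider together
  -- with `W`.
  no-spider⇒monochromatic : NoSpider s → (G : Graph n) → Member P G → (b : Bool) {W : List (Fin n)} →
    Unique W → Homogeneous G b W → 2 + (s + (s + s)) ≤ length W → Monochromatic G b
  no-spider⇒monochromatic {s} none G G∈P b u hom large with monochromatic? G b
  ... | inj₁ mono = mono
  ... | inj₂ (x , y , x≢y , xy) with homogeneous⇒spider-⊑ G b s u hom large x≢y xy
  ...   | d , spider⊑G = ⊥-elim (none b d (hereditary spider⊑G G∈P))

  no-spider⇒bounded-difference : NoSpider s → (G : Graph n) → Member P G →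
    similarityDifference G ≤ 2 + (s + (s + s))
  no-spider⇒bounded-difference {s} none G G∈P
    with ℕ.≤-<-connex (largestClassSize G) (2 + (s + (s + s)))
  ... | inj₁ small = ℕ.≤-trans (ℕ.m∸n≤m (largestClassSize G) (smallestClassSize G)) small
  ... | inj₂ large with largestClass G (ℕ.≤-<-trans z≤n large)
  ...   | x , S≡ with similarityClass-homogeneous G x
  ...     | b , W , u , hom , size = ℕ.≤-trans (ℕ.≤-reflexive (monochromatic⇒difference≡0 G
              (no-spider⇒monochromatic none G G∈P b u hom
                -- The strict inequality `large` makes up for the vertex that `W` lacks from the
                -- class.
                (s≤s⁻¹ (ℕ.≤-trans large (ℕ.≤-trans (ℕ.≤-reflexive S≡) size)))))) z≤n

  large⇒monochromatic : (r : ℕ) → NoSpider s → r ≡ 2 + (s + (s + s)) → 2 ^ (r + r) ≤ n →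
    (G : Graph n) → Member P G → ∃[ b ] Monochromatic G b
  large⇒monochromatic {s} {n} r none r≡ large G G∈P with ramsey G r r (allFin n) (allFin⁺ n)
    (ℕ.≤-trans large (ℕ.≤-reflexive (sym (length-tabulate {n = n} (λ i → i)))))
  ... | inj₁ (W , u , _ , size , hom) =
    true  , no-spider⇒monochromatic none G G∈P true  u hom (ℕ.≤-reflexive (sym (trans size r≡)))
  ... | inj₂ (W , u , _ , size , hom) =
    false , no-spider⇒monochromatic none G G∈P false u hom (ℕ.≤-reflexive (sym (trans size r≡)))

  -- Monochromatic graphs of one colour on the same vertices are equal, so the colour is an
  -- injection from the codes of members into `Bool`.
  monochromatic⇒speed≤2 : (n : ℕ) →
    ((G : Graph n) → Member P G → ∃[ b ] Monochromatic G b) → speed n ≤ 2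
  monochromatic⇒speed≤2 n mono = injective⇒≤ {f = Inverse.from 2↔Bool ∘ colour}
    (same-colour ∘ Injection.injective (↔⇒↣ (↔-sym 2↔Bool)))
    where
    open Inverse (isSpeed n)
    monochromatic : ∀ i → ∃[ b ] Monochromatic (proj₁ (from i)) b
    monochromatic i = mono (proj₁ (from i)) (proj₂ (from i))
    colour : Fin (speed n) → Bool
    colour i = proj₁ (monochromatic i)
    same-colour : ∀ {i j} → colour i ≡ colour j → i ≡ j
    same-colour {i} {j} eq = trans (sym (strictlyInverseˡ i)) (inverseˡ
      (monochromatic⇒≈ {G = proj₁ (from i)} {proj₁ (from j)} (proj₂ (monochromatic i))
        (subst (Monochromatic (proj₁ (from j))) (sym eq) (proj₂ (monochromatic j)))))

  -- The two implications.

  bounded-speed⇒bounded-difference : speed =O (λ _ → 1) →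
    ∃[ k ] ∀ {n} (G : Graph n) → Member P G → similarityDifference G ≤ k
  bounded-speed⇒bounded-difference (c , N , bounded) =
    _ , no-spider⇒bounded-difference (bounded-speed⇒no-spider c N λ n N≤n →
      ℕ.≤-trans (bounded n N≤n) (ℕ.≤-reflexive (ℕ.*-identityʳ c)))

  no-spider⇒bounded-speed : NoSpider s → speed =O (λ _ → 1)
  no-spider⇒bounded-speed {s} none = 2 , 2 ^ (r + r) , λ n large →
    monochromatic⇒speed≤2 n (large⇒monochromatic r none refl large)
    where
    r = 2 + (s + (s + s))

  bounded-difference⇒constant-speed :
    (∃[ k ] ∀ {n} (G : Graph n) → Member P G → similarityDifference G ≤ k) → speed =Θ (λ _ → 1)
  bounded-difference⇒constant-speed (k , bounded) =
    -- A spider with `3 + k` leaves has difference at least `(3 + k) ∸ 2`, which is `k + 1`.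
    no-spider⇒bounded-speed (bounded-difference⇒no-spider k (3 + k) ℕ.≤-refl bounded) ,
    -- The lower bound on the speed holds from `n = 0` on, as there is a member of every size.
    (1 , 0 , λ n _ → ℕ.≤-trans (0<speed n) (ℕ.≤-reflexive (sym (ℕ.*-identityˡ (speed n)))))

theorem14 : {ℓ : Level} (P : GraphProperty ℓ) → Hereditary P →
    (speed : ℕ → ℕ) → IsSpeed P speed →
    (speed =Θ (λ _ → 1)) ⇔
    (∃[ k ] ∀ {n} (G : Graph n) → Member P G → similarityDifference G ≤ k)
theorem14 P hereditary speed isSpeed = mk⇔
  (bounded-speed⇒bounded-difference P hereditary speed isSpeed ∘ proj₁)
  (bounded-difference⇒constant-speed P hereditary speed isSpeed)
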